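{- Let $n,k$ be integers with $k \geq 2$ and $n \geq 50k^2$, and let $X=\{1,\ldots,n\}$. Suppose that $\mathcal F \subset \binom{X}{k}$ is intersecting. Then $$|\mathcal I(\mathcal F)| \leq |\mathcal I(\mathcal A)|,$$ where $\mathcal A := \left\{A \in \binom{X}{k}\colon |A \cap \{1,2,3\}| \geq 2\right\}$.
   Context: $\binom{X}{k}$ denotes the family of all $k$-element subsets of $X$. A family $\mathcal F$ is intersecting if $F \cap F' \neq \emptyset$ for all $F,F' \in \mathcal F$. For a family $\mathcal F$, $\mathcal I(\mathcal F) := \{F \cap F'\colon F, F' \in \mathcal F,\ F \neq F'\}$ is the family of all distinct pairwise intersections of distinct members. -}

module Defs where

open import Data.Nat using (ℕ; _≤_; _≥_; _*_; _+_)
open import Data.Fin using (Fin; toℕ)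
open import Data.Fin.Subset using (Subset; _∩_; ∣_∣; _∈_)
open import Data.List using (List; length)
open import Data.List.Relation.Unary.Unique.Propositional using (Unique)
import Data.List.Membership.Propositional as LM
open import Data.Product using (Σ; ∃; _×_; _,_)
open import Relation.Binary.PropositionalEquality using (_≡_; _≢_)
open import Relation.Nullary using (¬_)
open import Relation.Unary using (Pred)
open import Level using (0ℓ)
open import Data.Vec using (tabulate)
open import Data.Nat using (_<ᵇ_)

-- Subsets of X = {1,…,n} are modelled as Subset n (element i : Fin n stands for toℕ i + 1).

Family : ℕ → Set₁
Family n = Pred (Subset n) 0ℓ

IsKUniform : {n : ℕ} → ℕ → Family n → Set
IsKUniform k F = ∀ A → F A → ∣ A ∣ ≡ k

Intersecting : {n : ℕ} → Family n → Set
Intersecting {n} F = ∀ A B → F A → F B → Σ (Fin n) λ x → x ∈ (A ∩ B)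

𝓘 : {n : ℕ} → Family n → Family n
𝓘 F C = Σ _ λ A → Σ _ λ B → F A × F B × A ≢ B × C ≡ A ∩ B

Enumerates : {n : ℕ} → List (Subset n) → Family n → Set
Enumerates L P = Unique L × (∀ C → (C LM.∈ L → P C) × (P C → C LM.∈ L))

HasSize : {n : ℕ} → Family n → ℕ → Set
HasSize P m = Σ _ λ L → Enumerates L P × length L ≡ m

Three : (n : ℕ) → Subset n
Three n = tabulate λ i → toℕ i <ᵇ 3

𝓐 : (n k : ℕ) → Family n
𝓐 n k A = (∣ A ∣ ≡ k) × (2 ≤ ∣ A ∩ Three n ∣)

members : {n : ℕ} → List (Subset n) → Family n
members L A = A LM.∈ L

{-# OPTIONS --safe #-}
module Submission where

-- 𝓘(𝓐) consists of all sets with fewer than k elements that meet {1,2,3}, so it is enough to show that an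
-- intersecting family F has at most as many intersections as there are such sets. Enlarge F to a maximal
-- intersecting family G of sets of size at most k, and let o be a point for which the smallest member of G
-- avoiding o is as large as possible, of size t. If there is no such member, all intersections contain o. If
-- t ≤ 2, then G contains a triangle, and all intersections meet its three vertices. If t ≥ 3, an intersection
-- contains o, or has fewer than k - 1 elements, or arises by deleting one point from a member A of F with o ∉ A.
-- Such an A contains no member of G with fewer than t elements, so branching over members of G disjoint from
-- what has been chosen so far shows that A contains one of t² k^(t-2) sets of size t. For n ≥ 50k² the third
-- kind of intersections is therefore so rare that the total stays below the bound.

open import Defs
open import Data.Bool using (false)
import Data.Bool.Properties as Bool
open import Data.Fin using (Fin; zero; suc)
open import Data.Fin.Properties using (_≟_; any?)
open import Data.Fin.Subset using (Subset; inside; outside; Nonempty; _∩_; _∪_; _-_; ∁; ⊤; ⊥; ⁅_⁆; ∣_∣; _∈_; _∉_; _⊆_)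
open import Data.Fin.Subset.Properties
open import Data.List using (List; []; _∷_; _++_; length; map)
open import Data.List.Properties using (length-map; length-++)
import Data.List.Membership.DecPropositional as DecMembership
import Data.List.Membership.Propositional as LM
open import Data.List.Membership.Propositional.Properties using (∈-map⁺; ∈-++⁺ˡ; ∈-++⁺ʳ)
open import Data.List.Relation.Unary.All as All using (All; []; _∷_)
import Data.List.Relation.Unary.All.Properties as All
open import Data.List.Relation.Unary.AllPairs using ([]; _∷_)
open import Data.List.Relation.Unary.Any using (Any; here; there)
import Data.List.Relation.Unary.Any.Properties as Any
open import Data.List.Relation.Unary.Unique.Propositional using (Unique)
open import Data.Nat using (ℕ; zero; suc; _+_; _*_; _^_; _∸_; _≤_; _<_; _<?_; _≤?_; z≤n; s≤s; s≤s⁻¹; ⌊_/2⌋; ⌈_/2⌉)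
open import Data.Nat.Properties hiding (_≟_)
open import Data.Nat.Tactic.RingSolver using (solve-∀)
open import Data.Product using (∃; _×_; _,_; proj₁; proj₂)
open import Data.Sum using (_⊎_; inj₁; inj₂; [_,_]′)
open import Data.Vec using ([]; _∷_; here; there; tabulate)
open import Data.Vec.Properties using (≡-dec; lookup∘tabulate; []=⇒lookup)
open import Function using (_∘_; id)
open import Relation.Binary.PropositionalEquality using (_≡_; _≢_; refl; sym; trans; cong; cong₂; subst)
open import Relation.Nullary using (¬_; Dec; yes; no; contradiction; _×-dec_; _→-dec_; ¬?)
open import Relation.Nullary.Decidable using (decidable-stable)

private
  variable
    n : ℕ
    P Q : Set

-- Counting subsets

-- ball m k is the number of subsets of an m-element set with fewer than k elements.
ball : ℕ → ℕ → ℕ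
ball m       zero    = 0
ball zero    (suc k) = 1
ball (suc m) (suc k) = ball m k + ball m (suc k)

ball-suc : ∀ m k → ball m k ≤ ball m (suc k)
ball-suc m       zero    = z≤n
ball-suc zero    (suc k) = ≤-refl
ball-suc (suc m) (suc k) = +-mono-≤ (ball-suc m k) (ball-suc m (suc k))

ball-sucˡ : ∀ m k → ball m k ≤ ball (suc m) k
ball-sucˡ m zero    = z≤n
ball-sucˡ m (suc k) = m≤n+m (ball m (suc k)) (ball m k)

ball-monoˡ : ∀ {m m′} k → m ≤ m′ → ball m k ≤ ball m′ k
ball-monoˡ {m} {m′} k m≤m′ = subst (λ x → ball m k ≤ ball x k) (m∸n+n≡m m≤m′) (go (m′ ∸ m))
  where
  go : ∀ d → ball m k ≤ ball (d + m) k
  go zero    = ≤-refl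
  go (suc d) = ≤-trans (go d) (ball-sucˡ (d + m) k)

-- Summed form of (i + 1) C(m, i + 1) = (m - i) C(m, i), with the subtraction moved across.
ball-ratio : ∀ m j → suc m * ball m j ≤ j * ball m (suc j) + j * ball m j
ball-ratio m       zero    = ≤-reflexive (*-zeroʳ m)
ball-ratio zero    (suc j) = s≤s z≤n
ball-ratio (suc m) (suc j) = begin
  suc (suc m) * (a + b)                                  ≡⟨ expand m a b ⟩
  (suc m * a + suc m * b) + (a + b)                      ≤⟨ +-monoˡ-≤ (a + b) (+-mono-≤ (ball-ratio m j) (ball-ratio m (suc j))) ⟩
  ((j * b + j * a) + (suc j * c + suc j * b)) + (a + b)  ≡⟨ collect j a b c ⟩
  suc j * (b + c) + suc j * (a + b)                      ∎
  where
  open ≤-Reasoning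
  a = ball m j
  b = ball m (suc j)
  c = ball m (suc (suc j))
  expand : ∀ m a b → suc (suc m) * (a + b) ≡ (suc m * a + suc m * b) + (a + b)
  expand = solve-∀
  collect : ∀ j a b c → ((j * b + j * a) + (suc j * c + suc j * b)) + (a + b) ≡ suc j * (b + c) + suc j * (a + b)
  collect = solve-∀

-- Sizes of families as sums over the power set

ind : Dec P → ℕ
ind (yes _) = 1
ind (no _)  = 0

ind-yes : (p? : Dec P) → P → ind p? ≡ 1
ind-yes (yes _) p = refl
ind-yes (no ¬p) p = contradiction p ¬p

ind-no : (p? : Dec P) → ¬ P → ind p? ≡ 0
ind-no (yes p) ¬p = contradiction p ¬p
ind-no (no _)  ¬p = refl

ind-cong : (p? : Dec P) (q? : Dec Q) → (P → Q) → (Q → P) → ind p? ≡ ind q?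
ind-cong (yes p) q? f g = sym (ind-yes q? (f p))
ind-cong (no ¬p) q? f g = sym (ind-no q? (¬p ∘ g))

-- Families are counted by summing over all subsets of the ground set. Comparing two families then
-- reduces to a pointwise inequality, and the recursion follows the first coordinate as `ball` does.
total : (Subset n → ℕ) → ℕ
total {zero}  f = f []
total {suc n} f = total (λ D → f (inside ∷ D)) + total (λ D → f (outside ∷ D))

total-mono : {f g : Subset n → ℕ} → (∀ D → f D ≤ g D) → total f ≤ total g
total-mono {zero}  f≤g = f≤g []
total-mono {suc n} f≤g = +-mono-≤ (total-mono (λ D → f≤g (inside ∷ D))) (total-mono (λ D → f≤g (outside ∷ D)))

total-cong : {f g : Subset n → ℕ} → (∀ D → f D ≡ g D) → total f ≡ total g
total-cong f≡g = ≤-antisym (total-mono (≤-reflexive ∘ f≡g)) (total-mono (≤-reflexive ∘ sym ∘ f≡g))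

total-+ : (f g : Subset n → ℕ) → total (λ D → f D + g D) ≡ total f + total g
total-+ {zero}  f g = refl
total-+ {suc n} f g = trans
  (cong₂ _+_ (total-+ (f ∘ (inside ∷_)) (g ∘ (inside ∷_))) (total-+ (f ∘ (outside ∷_)) (g ∘ (outside ∷_))))
  (interchange (total (f ∘ (inside ∷_))) (total (g ∘ (inside ∷_))) (total (f ∘ (outside ∷_))) (total (g ∘ (outside ∷_))))
  where
  interchange : ∀ a b c d → (a + b) + (c + d) ≡ (a + c) + (b + d)
  interchange = solve-∀

total-zero : {f : Subset n → ℕ} → (∀ D → f D ≡ 0) → total f ≡ 0
total-zero {zero}  f≡0 = f≡0 []
total-zero {suc n} f≡0 = cong₂ _+_ (total-zero (λ D → f≡0 (inside ∷ D))) (total-zero (λ D → f≡0 (outside ∷ D)))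

infix 4 _≟ₛ_
_≟ₛ_ : (D E : Subset n) → Dec (D ≡ E)
_≟ₛ_ = ≡-dec Bool._≟_

total-single : (E : Subset n) → total (λ D → ind (D ≟ₛ E)) ≡ 1
total-single []            = refl
total-single (inside ∷ E)  = cong₂ _+_
  (trans (total-cong (λ D → ind-cong (inside ∷ D ≟ₛ inside ∷ E) (D ≟ₛ E) (λ { refl → refl }) (cong (inside ∷_)))) (total-single E))
  (total-zero (λ D → ind-no (outside ∷ D ≟ₛ inside ∷ E) (λ ())))
total-single (outside ∷ E) = cong₂ _+_
  (total-zero (λ D → ind-no (inside ∷ D ≟ₛ outside ∷ E) (λ ())))
  (trans (total-cong (λ D → ind-cong (outside ∷ D ≟ₛ outside ∷ E) (D ≟ₛ E) (λ { refl → refl }) (cong (outside ∷_)))) (total-single E))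

-- Links enumerations to sums: `total` of this function is the length of the list, and on a
-- duplicate-free list it is at most 1.
multiplicity : List (Subset n) → Subset n → ℕ
multiplicity []      D = 0
multiplicity (E ∷ L) D = ind (D ≟ₛ E) + multiplicity L D

total-multiplicity : (L : List (Subset n)) → total (multiplicity L) ≡ length L
total-multiplicity {n} []  = total-zero {n} (λ _ → refl)
total-multiplicity (E ∷ L) = trans (total-+ (λ D → ind (D ≟ₛ E)) (multiplicity L))
  (cong₂ _+_ (total-single E) (total-multiplicity L))

∉⇒multiplicity≡0 : (L : List (Subset n)) {D : Subset n} → ¬ (D LM.∈ L) → multiplicity L D ≡ 0
∉⇒multiplicity≡0 []      D∉L = refl
∉⇒multiplicity≡0 (E ∷ L) D∉L = cong₂ _+_ (ind-no (_ ≟ₛ E) (D∉L ∘ here)) (∉⇒multiplicity≡0 L (D∉L ∘ there))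

∈⇒1≤multiplicity : {L : List (Subset n)} {D : Subset n} → D LM.∈ L → 1 ≤ multiplicity L D
∈⇒1≤multiplicity {L = E ∷ L} {D} (here D≡E)  = ≤-trans (≤-reflexive (sym (ind-yes (D ≟ₛ E) D≡E))) (m≤m+n _ _)
∈⇒1≤multiplicity {L = E ∷ L} {D} (there D∈L) = ≤-trans (∈⇒1≤multiplicity D∈L) (m≤n+m _ (ind (D ≟ₛ E)))

Unique⇒multiplicity≤1 : {L : List (Subset n)} → Unique L → ∀ D → multiplicity L D ≤ 1
Unique⇒multiplicity≤1 []                         D = z≤n
Unique⇒multiplicity≤1 {L = E ∷ L} (E∉L ∷ unique) D with D ≟ₛ E
... | no _     = Unique⇒multiplicity≤1 unique D
... | yes refl = s≤s (≤-reflexive (∉⇒multiplicity≡0 L (λ E∈L → All.lookup E∉L E∈L refl)))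

length≤total : {L : List (Subset n)} {f : Subset n → ℕ} → Unique L → (∀ D → D LM.∈ L → 1 ≤ f D) → length L ≤ total f
length≤total {L = L} {f} unique 1≤f = subst (_≤ total f) (total-multiplicity L) (total-mono bound)
  where
  open DecMembership (_≟ₛ_ {_}) using () renaming (_∈?_ to _∈ˡ?_)
  bound : ∀ D → multiplicity L D ≤ f D
  bound D with D ∈ˡ? L
  ... | yes D∈L = ≤-trans (Unique⇒multiplicity≤1 unique D) (1≤f D D∈L)
  ... | no  D∉L = ≤-trans (≤-reflexive (∉⇒multiplicity≡0 L D∉L)) z≤n

total-ind≤length : {L : List (Subset n)} {P : Subset n → Set} (P? : ∀ D → Dec (P D)) → (∀ D → P D → D LM.∈ L) → total (λ D → ind (P? D)) ≤ length L
total-ind≤length {L = L} P? P⇒∈ = subst (total (λ D → ind (P? D)) ≤_) (total-multiplicity L) (total-mono bound)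
  where
  bound : ∀ D → ind (P? D) ≤ multiplicity L D
  bound D with P? D
  ... | yes p = ∈⇒1≤multiplicity (P⇒∈ D p)
  ... | no  _ = z≤n

-- Numbers of small sets inside, above or meeting a given set

Within : Subset n → ℕ → Subset n → Set
Within U k D = D ⊆ U × ∣ D ∣ < k

within? : (U : Subset n) (k : ℕ) (D : Subset n) → Dec (Within U k D)
within? U k D = (D ⊆? U) ×-dec (∣ D ∣ <? k)

total-within : (U : Subset n) (k : ℕ) → total (λ D → ind (within? U k D)) ≡ ball ∣ U ∣ k
total-within U             zero    = total-zero (λ D → ind-no (within? U 0 D) (λ ()))
total-within []            (suc k) = ind-yes (within? [] (suc k) []) (id , s≤s z≤n)
total-within (inside ∷ U)  (suc k) = cong₂ _+_
  (trans (total-cong (λ D → ind-cong (within? (inside ∷ U) (suc k) (inside ∷ D)) (within? U k D)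
    (λ (sub , lt) → drop-∷-⊆ sub , s≤s⁻¹ lt) (λ (sub , lt) → in⊆in sub , s≤s lt))) (total-within U k))
  (trans (total-cong (λ D → ind-cong (within? (inside ∷ U) (suc k) (outside ∷ D)) (within? U (suc k) D)
    (λ (sub , lt) → drop-∷-⊆ sub , lt) (λ (sub , lt) → out⊆ sub , lt))) (total-within U (suc k)))
total-within (outside ∷ U) (suc k) = cong₂ _+_
  (total-zero (λ D → ind-no (within? (outside ∷ U) (suc k) (inside ∷ D)) (λ (sub , _) → contradiction (sub here) (λ ()))))
  (trans (total-cong (λ D → ind-cong (within? (outside ∷ U) (suc k) (outside ∷ D)) (within? U (suc k) D)
    (λ (sub , lt) → drop-∷-⊆ sub , lt) (λ (sub , lt) → out⊆ sub , lt))) (total-within U (suc k)))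

Above : Subset n → ℕ → Subset n → Set
Above V k D = V ⊆ D × ∣ D ∣ < k

above? : (V : Subset n) (k : ℕ) (D : Subset n) → Dec (Above V k D)
above? V k D = (V ⊆? D) ×-dec (∣ D ∣ <? k)

-- Removing `V` from `D` leaves an arbitrary subset of `∁ V` with fewer than `i` elements.
total-above : (V : Subset n) (i : ℕ) → total (λ D → ind (above? V (∣ V ∣ + i) D)) ≡ ball ∣ ∁ V ∣ i
total-above []            zero    = ind-no (above? [] 0 []) (λ ())
total-above []            (suc i) = ind-yes (above? [] (suc i) []) (id , s≤s z≤n)
total-above (inside ∷ V)  i       = trans (cong₂ _+_
  (trans (total-cong (λ D → ind-cong (above? (inside ∷ V) (suc (∣ V ∣ + i)) (inside ∷ D)) (above? V (∣ V ∣ + i) D)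
    (λ (sub , lt) → drop-∷-⊆ sub , s≤s⁻¹ lt) (λ (sub , lt) → in⊆in sub , s≤s lt))) (total-above V i))
  (total-zero (λ D → ind-no (above? (inside ∷ V) (suc (∣ V ∣ + i)) (outside ∷ D)) (λ (sub , _) → contradiction (sub here) (λ ())))))
  (+-identityʳ _)
total-above (outside ∷ V) zero    = total-zero (λ D → ind-no (above? (outside ∷ V) (∣ V ∣ + 0) D)
  (λ (sub , lt) → <⇒≱ lt (≤-trans (≤-reflexive (+-identityʳ ∣ V ∣)) (p⊆q⇒∣p∣≤∣q∣ sub))))
total-above (outside ∷ V) (suc i) = cong₂ _+_
  (trans (total-cong (λ D → ind-cong (above? (outside ∷ V) (∣ V ∣ + suc i) (inside ∷ D)) (above? V (∣ V ∣ + i) D)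
    (λ (sub , lt) → drop-∷-⊆ sub , s≤s⁻¹ (subst (suc ∣ D ∣ <_) (+-suc ∣ V ∣ i) lt))
    (λ (sub , lt) → out⊆ sub , subst (suc ∣ D ∣ <_) (sym (+-suc ∣ V ∣ i)) (s≤s lt)))) (total-above V i))
  (trans (total-cong (λ D → ind-cong (above? (outside ∷ V) (∣ V ∣ + suc i) (outside ∷ D)) (above? V (∣ V ∣ + suc i) D)
    (λ (sub , lt) → drop-∷-⊆ sub , lt) (λ (sub , lt) → out⊆ sub , lt))) (total-above V (suc i)))

Meets : Subset n → ℕ → Subset n → Set
Meets T k D = ¬ (D ⊆ ∁ T) × ∣ D ∣ < k

meets? : (T : Subset n) (k : ℕ) (D : Subset n) → Dec (Meets T k D)
meets? T k D = ¬? (D ⊆? ∁ T) ×-dec (∣ D ∣ <? k)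

-- A set either meets `T` or lies in `∁ T`. The count is stated additively to avoid truncated
-- subtraction.
total-meets : (T : Subset n) (k : ℕ) → total (λ D → ind (meets? T k D)) + ball ∣ ∁ T ∣ k ≡ ball n k
total-meets {n} T k = begin-equality
  total (λ D → ind (meets? T k D)) + ball ∣ ∁ T ∣ k                               ≡⟨ cong (total (λ D → ind (meets? T k D)) +_) (total-within (∁ T) k) ⟨
  total (λ D → ind (meets? T k D)) + total (λ D → ind (within? (∁ T) k D))        ≡⟨ total-+ (λ D → ind (meets? T k D)) (λ D → ind (within? (∁ T) k D)) ⟨
  total (λ D → ind (meets? T k D) + ind (within? (∁ T) k D))                      ≡⟨ total-cong split ⟩
  total (λ D → ind (within? (⊤ {n}) k D))                                         ≡⟨ trans (total-within (⊤ {n}) k) (cong (λ x → ball x k) (∣⊤∣≡n n)) ⟩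
  ball n k                                                                        ∎
  where
  open ≤-Reasoning
  split : ∀ D → ind (meets? T k D) + ind (within? (∁ T) k D) ≡ ind (within? ⊤ k D)
  split D with D ⊆? ∁ T | ∣ D ∣ <? k
  ... | yes sub | yes lt = sym (ind-yes (D ⊆? ⊤ ×-dec yes lt) (⊆⊤ , lt))
  ... | yes sub | no ≮  = sym (ind-no (D ⊆? ⊤ ×-dec no ≮) (≮ ∘ proj₂))
  ... | no ⊈  | yes lt = sym (ind-yes (D ⊆? ⊤ ×-dec yes lt) (⊆⊤ , lt))
  ... | no ⊈  | no ≮  = sym (ind-no (D ⊆? ⊤ ×-dec no ≮) (≮ ∘ proj₂))

-- The intersections of 𝓐

-- The first r elements of the complement of D, in increasing order, go alternately to deal₁ and deal₂;
-- starting that way, a D with one element in {1,2,3} gives each of them a different one of the other two.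
deal₁ deal₂ : Subset n → ℕ → Subset n
deal₁ []            r       = []
deal₁ (inside ∷ D)  r       = inside ∷ deal₁ D r
deal₁ (outside ∷ D) zero    = outside ∷ deal₁ D zero
deal₁ (outside ∷ D) (suc r) = inside ∷ deal₂ D r
deal₂ []            r       = []
deal₂ (inside ∷ D)  r       = inside ∷ deal₂ D r
deal₂ (outside ∷ D) zero    = outside ∷ deal₂ D zero
deal₂ (outside ∷ D) (suc r) = outside ∷ deal₁ D r

-- Each dealt point goes to only one side. Both orders are proved together because `deal₁` and
-- `deal₂` swap roles after every dealt point.
deal-∩ : (D : Subset n) (r : ℕ) → deal₁ D r ∩ deal₂ D r ≡ D × deal₂ D r ∩ deal₁ D r ≡ D
deal-∩ []            r       = refl , refl
deal-∩ (inside ∷ D)  r       = cong (inside ∷_) (proj₁ (deal-∩ D r)) , cong (inside ∷_) (proj₂ (deal-∩ D r))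
deal-∩ (outside ∷ D) zero    = cong (outside ∷_) (proj₁ (deal-∩ D zero)) , cong (outside ∷_) (proj₂ (deal-∩ D zero))
deal-∩ (outside ∷ D) (suc r) = cong (outside ∷_) (proj₂ (deal-∩ D r)) , cong (outside ∷_) (proj₁ (deal-∩ D r))

∣deal∣ : (D : Subset n) (r : ℕ) → r ≤ ∣ ∁ D ∣ → ∣ deal₁ D r ∣ ≡ ∣ D ∣ + ⌈ r /2⌉ × ∣ deal₂ D r ∣ ≡ ∣ D ∣ + ⌊ r /2⌋
∣deal∣ []            zero    r≤ = refl , refl
∣deal∣ (inside ∷ D)  r       r≤ = cong suc (proj₁ (∣deal∣ D r r≤)) , cong suc (proj₂ (∣deal∣ D r r≤))
∣deal∣ (outside ∷ D) zero    r≤ = ∣deal∣ D zero z≤n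
∣deal∣ (outside ∷ D) (suc r) r≤ =
  trans (cong suc (proj₂ (∣deal∣ D r (s≤s⁻¹ r≤)))) (sym (+-suc ∣ D ∣ ⌊ r /2⌋)) , proj₁ (∣deal∣ D r (s≤s⁻¹ r≤))

x∉Three : (x : Fin n) → suc (suc (suc x)) ∉ Three (3 + n)
x∉Three x (there (there (there x∈))) with trans (sym (lookup∘tabulate (λ _ → false) x)) ([]=⇒lookup x∈)
... | ()

2≤deal∩Three : (D : Subset (3 + n)) (r : ℕ) → ¬ (D ⊆ ∁ (Three (3 + n))) →
  2 ≤ ∣ deal₁ D (suc (suc r)) ∩ Three (3 + n) ∣ × 2 ≤ ∣ deal₂ D (suc (suc r)) ∩ Three (3 + n) ∣
2≤deal∩Three (inside  ∷ inside  ∷ inside  ∷ D) r ⊈ = s≤s (s≤s z≤n) , s≤s (s≤s z≤n)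
2≤deal∩Three (inside  ∷ inside  ∷ outside ∷ D) r ⊈ = s≤s (s≤s z≤n) , s≤s (s≤s z≤n)
2≤deal∩Three (inside  ∷ outside ∷ inside  ∷ D) r ⊈ = s≤s (s≤s z≤n) , s≤s (s≤s z≤n)
2≤deal∩Three (inside  ∷ outside ∷ outside ∷ D) r ⊈ = s≤s (s≤s z≤n) , s≤s (s≤s z≤n)
2≤deal∩Three (outside ∷ inside  ∷ inside  ∷ D) r ⊈ = s≤s (s≤s z≤n) , s≤s (s≤s z≤n)
2≤deal∩Three (outside ∷ inside  ∷ outside ∷ D) r ⊈ = s≤s (s≤s z≤n) , s≤s (s≤s z≤n)
2≤deal∩Three (outside ∷ outside ∷ inside  ∷ D) r ⊈ = s≤s (s≤s z≤n) , s≤s (s≤s z≤n)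
2≤deal∩Three (outside ∷ outside ∷ outside ∷ D) r ⊈ =
  contradiction (λ { (there (there (there {i = x} _))) → x∉p⇒x∈∁p (x∉Three x) }) ⊈

-- Dealing 2 (k - |D|) points fills both sides up to `k` elements. There is room for this, since |D|
-- + 2 (k - |D|) ≤ 2k ≤ n. The two sides differ because their intersection `D` has fewer than `k`
-- elements.
Meets⇒𝓘𝓐 : ∀ m k → k + k ≤ 3 + m → ∀ D → Meets (Three (3 + m)) k D → 𝓘 (𝓐 (3 + m) k) D
Meets⇒𝓘𝓐 m k 2k≤n D (⊈ , ∣D∣<k) = A , B , (∣A∣≡k , proj₁ two) , (∣B∣≡k , proj₂ two) , A≢B , sym A∩B≡D
  where
  s = k ∸ suc ∣ D ∣
  ∣D∣+s≡k : ∣ D ∣ + suc s ≡ k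
  ∣D∣+s≡k = trans (+-suc ∣ D ∣ s) (m+[n∸m]≡n ∣D∣<k)
  -- Twice `suc s`, written with the two leading successors that `2≤deal∩Three` asks for.
  r = suc (suc (s + s))
  r≡2s : r ≡ suc s + suc s
  r≡2s = cong suc (sym (+-suc s s))
  A = deal₁ D r
  B = deal₂ D r
  s≤k : suc s ≤ k
  s≤k = subst (suc s ≤_) ∣D∣+s≡k (m≤n+m (suc s) ∣ D ∣)
  r≤ : r ≤ ∣ ∁ D ∣
  r≤ = begin
    r                                     ≡⟨ r≡2s ⟩
    suc s + suc s                         ≡⟨ m+n∸m≡n ∣ D ∣ (suc s + suc s) ⟨
    ∣ D ∣ + (suc s + suc s) ∸ ∣ D ∣       ≡⟨ cong (_∸ ∣ D ∣) (+-assoc ∣ D ∣ (suc s) (suc s)) ⟨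
    ∣ D ∣ + suc s + suc s ∸ ∣ D ∣         ≡⟨ cong (λ x → x + suc s ∸ ∣ D ∣) ∣D∣+s≡k ⟩
    k + suc s ∸ ∣ D ∣                     ≤⟨ ∸-monoˡ-≤ ∣ D ∣ (≤-trans (+-monoʳ-≤ k s≤k) 2k≤n) ⟩
    3 + m ∸ ∣ D ∣                         ≡⟨ ∣∁p∣≡n∸∣p∣ D ⟨
    ∣ ∁ D ∣                               ∎
    where open ≤-Reasoning
  two = 2≤deal∩Three D (s + s) ⊈
  ∣A∣≡k : ∣ A ∣ ≡ k
  ∣A∣≡k = trans (proj₁ (∣deal∣ D r r≤)) (trans (cong (∣ D ∣ +_) (trans (cong ⌈_/2⌉ r≡2s) (sym (n≡⌈n+n/2⌉ (suc s))))) ∣D∣+s≡k)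
  ∣B∣≡k : ∣ B ∣ ≡ k
  ∣B∣≡k = trans (proj₂ (∣deal∣ D r r≤)) (trans (cong (∣ D ∣ +_) (trans (cong ⌊_/2⌋ r≡2s) (sym (n≡⌊n+n/2⌋ (suc s))))) ∣D∣+s≡k)
  A∩B≡D : A ∩ B ≡ D
  A∩B≡D = proj₁ (deal-∩ D r)
  A≢B : A ≢ B
  A≢B A≡B = <-irrefl (trans (cong ∣_∣ (trans (sym A∩B≡D) (trans (cong (A ∩_) (sym A≡B)) (∩-idem A)))) ∣A∣≡k) ∣D∣<k

-- The lower bound for `q`: among the sets with fewer than `k` elements, `ball m k` bounds the
-- number of those that avoid {1,2,3}, and all others are intersections of `𝓐`.
ball≤∣𝓘𝓐∣ : ∀ m k q → k + k ≤ 3 + m → HasSize (𝓘 (𝓐 (3 + m) k)) q → ball (3 + m) k ≤ q + ball m k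
ball≤∣𝓘𝓐∣ m k q 2k≤n (L , (_ , enum) , refl) = begin
  ball (3 + m) k                                                 ≡⟨ total-meets T k ⟨
  total (λ D → ind (meets? T k D)) + ball ∣ ∁ T ∣ k              ≤⟨ +-mono-≤ (total-ind≤length (meets? T k) (λ D → proj₂ (enum D) ∘ Meets⇒𝓘𝓐 m k 2k≤n D))
                                                                              (ball-monoˡ k (∣p∣≤n (∁ (tabulate {n = m} (λ _ → false))))) ⟩
  length L + ball m k                                            ∎
  where
  open ≤-Reasoning
  T = Three (3 + m)

-- Growth of ball, for a ground set of size 3 + m

-- By `ball-ratio`, (m + 1 - j) `ball m j` ≤ j `ball m (suc j)`, and m + 1 - j ≥ 49kj because n ≥
-- 50k². For j = 0 the left side vanishes.
ball-growth : ∀ m k j → 3 ≤ k → suc j ≤ k → 50 * (k * k) ≤ 3 + m → 49 * k * ball m j ≤ ball m (suc j)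
ball-growth m k zero    3≤k j<k n≥ = ≤-trans (≤-reflexive (*-zeroʳ (49 * k))) z≤n
ball-growth m k j@(suc j′) 3≤k j<k n≥ = *-cancelˡ-≤ j (+-cancelʳ-≤ (j * ball m j) _ _ (begin
  j * (49 * k * ball m j) + j * ball m j   ≡⟨ factor j k (ball m j) ⟩
  (49 * (k * j) + j) * ball m j            ≤⟨ *-monoˡ-≤ (ball m j) coeff ⟩
  suc m * ball m j                         ≤⟨ ball-ratio m j ⟩
  j * ball m (suc j) + j * ball m j        ∎))
  where
  open ≤-Reasoning
  factor : ∀ j k b → j * (49 * k * b) + j * b ≡ (49 * (k * j) + j) * b
  factor = solve-∀
  j≤k = <⇒≤ j<k
  -- Of the 50k², the part 49k² absorbs 49kj. The remaining k² is at least 3k, which absorbs the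
  -- linear and constant terms.
  coeff : 49 * (k * j) + j ≤ suc m
  coeff = +-cancelˡ-≤ 2 _ _ (begin
    2 + (49 * (k * j) + j)     ≡⟨ shuffle (49 * (k * j)) j ⟩
    49 * (k * j) + 1 + suc j   ≤⟨ +-mono-≤ (+-mono-≤ (*-monoʳ-≤ 49 (*-monoʳ-≤ k j≤k)) (≤-trans (s≤s z≤n) 3≤k)) j<k ⟩
    49 * (k * k) + k + k       ≤⟨ +-monoʳ-≤ (49 * (k * k) + k) (m≤m+n k k) ⟩
    49 * (k * k) + k + (k + k) ≡⟨ collect k ⟩
    49 * (k * k) + k * 3       ≤⟨ +-monoʳ-≤ (49 * (k * k)) (*-monoʳ-≤ k 3≤k) ⟩
    49 * (k * k) + k * k       ≡⟨ collect′ (k * k) ⟩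
    50 * (k * k)               ≤⟨ n≥ ⟩
    3 + m                      ∎)
    where
    shuffle : ∀ x j → 2 + (x + j) ≡ x + 1 + suc j
    shuffle = solve-∀
    collect : ∀ k → 49 * (k * k) + k + (k + k) ≡ 49 * (k * k) + k * 3
    collect = solve-∀
    collect′ : ∀ x → 49 * x + x ≡ 50 * x
    collect′ = solve-∀

ball-growth-^ : ∀ m k u i → 3 ≤ k → u + i ≤ k → 50 * (k * k) ≤ 3 + m → (49 * k) ^ u * ball m i ≤ ball m (u + i)
ball-growth-^ m k zero    i 3≤k ui≤k n≥ = ≤-reflexive (*-identityˡ (ball m i))
ball-growth-^ m k (suc u) i 3≤k ui≤k n≥ = begin
  (49 * k) * (49 * k) ^ u * ball m i     ≡⟨ *-assoc (49 * k) ((49 * k) ^ u) (ball m i) ⟩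
  (49 * k) * ((49 * k) ^ u * ball m i)   ≤⟨ *-monoʳ-≤ (49 * k) (ball-growth-^ m k u i 3≤k (<⇒≤ ui≤k) n≥) ⟩
  49 * k * ball m (u + i)                ≤⟨ ball-growth m k (u + i) 3≤k ui≤k n≥ ⟩
  ball m (suc (u + i))                   ∎
  where open ≤-Reasoning

ball-double : ∀ m j → ball (suc m) j ≤ 2 * ball m j
ball-double m zero    = z≤n
ball-double m (suc j) = +-mono-≤ (ball-suc m j) (≤-reflexive (sym (+-identityʳ _)))

^-distribʳ-* : ∀ u a b → (a * b) ^ u ≡ a ^ u * b ^ u
^-distribʳ-* zero    a b = refl
^-distribʳ-* (suc u) a b = trans (cong (a * b *_) (^-distribʳ-* u a b)) ([m*n]*[o*p]≡[m*o]*[n*p] a b (a ^ u) (b ^ u))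

-- For t = 3 + u this is t³ ≤ 27 · 49^(t-3): equality at t = 3, and passing from t to t + 1
-- multiplies the left side by less than 49. It lets the growth of `ball` absorb the cubic factor of
-- `branches`.
cube≤ : ∀ u → (3 + u) * ((3 + u) * (3 + u)) ≤ 27 * 49 ^ u
cube≤ zero    = ≤-refl
cube≤ (suc u) = begin
  -- The added polynomial is the difference 49 (3 + u)³ - (4 + u)³.
  (4 + u) * ((4 + u) * (4 + u))                                                    ≤⟨ m≤m+n _ (1259 + 1275 * u + 429 * (u * u) + 48 * (u * u * u)) ⟩
  (4 + u) * ((4 + u) * (4 + u)) + (1259 + 1275 * u + 429 * (u * u) + 48 * (u * u * u)) ≡⟨ expand u ⟩
  49 * ((3 + u) * ((3 + u) * (3 + u)))                                             ≤⟨ *-monoʳ-≤ 49 (cube≤ u) ⟩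
  49 * (27 * 49 ^ u)                                                               ≡⟨ swap (49 ^ u) ⟩
  27 * (49 * 49 ^ u)                                                               ∎
  where
  open ≤-Reasoning
  expand : ∀ u → (4 + u) * ((4 + u) * (4 + u)) + (1259 + 1275 * u + 429 * (u * u) + 48 * (u * u * u)) ≡ 49 * ((3 + u) * ((3 + u) * (3 + u)))
  expand = solve-∀
  swap : ∀ x → 49 * (27 * x) ≡ 27 * (49 * x)
  swap = solve-∀

-- t · t² k^(t-2) for t = 3 + u: each of the t-sets found by branching has t subsets of size t - 1.
branches : ℕ → ℕ → ℕ
branches u k = (3 + u) * ((3 + u) * ((3 + u) * k ^ suc u))

-- The cube costs 27 · 49^u, and 49^u combines with k^u to (49k)^u, which is what `ball` gains in
-- `u` steps. Only 27k remains, whatever `u` is.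
branches*ball≤ : ∀ m k u i → 3 ≤ k → u + i ≤ k → 50 * (k * k) ≤ 3 + m → branches u k * ball m i ≤ 27 * k * ball m (u + i)
branches*ball≤ m k u i 3≤k ui≤k n≥ = begin
  branches u k * b                                       ≡⟨ group (3 + u) k (k ^ u) b ⟩
  (3 + u) * ((3 + u) * (3 + u)) * (k * (k ^ u * b))      ≤⟨ *-monoˡ-≤ (k * (k ^ u * b)) (cube≤ u) ⟩
  27 * 49 ^ u * (k * (k ^ u * b))                        ≡⟨ regroup (49 ^ u) k (k ^ u) b ⟩
  27 * k * (49 ^ u * k ^ u * b)                          ≡⟨ cong (λ x → 27 * k * (x * b)) (^-distribʳ-* u 49 k) ⟨
  27 * k * ((49 * k) ^ u * b)                            ≤⟨ *-monoʳ-≤ (27 * k) (ball-growth-^ m k u i 3≤k ui≤k n≥) ⟩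
  27 * k * ball m (u + i)                                ∎
  where
  open ≤-Reasoning
  b = ball m i
  group : ∀ t k x b → t * (t * (t * (k * x))) * b ≡ t * (t * t) * (k * (x * b))
  group = solve-∀
  regroup : ∀ y k x b → 27 * y * (k * (x * b)) ≡ 27 * k * (y * x * b)
  regroup = solve-∀

-- x counts the sets through o; the next two summands bound the intersections of the second and the third kind.
branching-bound : ∀ m u v → let k = 3 + (u + v) in 50 * (k * k) ≤ 3 + m → ∀ x → x + ball (2 + m) k ≡ ball (3 + m) k →
  x + ball (3 + m) (2 + (u + v)) + branches u k * ball (suc m) (suc v) + ball m k ≤ ball (3 + m) k
branching-bound m u v n≥ x x+≡ = begin
  -- By Pascal's rule the right side is `ball (2 + m) (2 + w)`, which equals `x`, plus
  -- `ball (1 + m) (2 + w)`, `ball m (2 + w)` and `ball m k`. After cancelling what occurs on both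
  -- sides, at most (27k + 7) `c` is left, to be fitted into `ball m (2 + w)`, which is at least 49k
  -- `c`.
  x + ball (3 + m) (2 + w) + R * ball (suc m) (suc v) + ball m k
    ≤⟨ +-monoˡ-≤ (ball m k) (+-mono-≤ (≤-reflexive (cong (_+ ball (3 + m) (2 + w)) x≡)) Rball≤) ⟩
  ball (2 + m) (2 + w) + (ball (2 + m) (1 + w) + (ball (1 + m) (1 + w) + ball (1 + m) (2 + w))) + (27 * k * c + c) + ball m k
    ≤⟨ +-monoˡ-≤ (ball m k) (+-monoˡ-≤ (27 * k * c + c) (+-monoʳ-≤ (ball (2 + m) (2 + w)) (+-mono-≤ (≤-trans (ball-double (suc m) (1 + w)) (*-monoʳ-≤ 2 (ball-double m (1 + w)))) (+-monoˡ-≤ (ball (1 + m) (2 + w)) (ball-double m (1 + w)))))) ⟩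
  ball (2 + m) (2 + w) + (2 * (2 * c) + (2 * c + ball (1 + m) (2 + w))) + (27 * k * c + c) + ball m k
    ≡⟨ collect (ball (2 + m) (2 + w)) c (ball (1 + m) (2 + w)) k (ball m k) ⟩
  ball (2 + m) (2 + w) + (ball (1 + m) (2 + w) + ((27 * k + 7) * c + ball m k))
    ≤⟨ +-monoʳ-≤ (ball (2 + m) (2 + w)) (+-monoʳ-≤ (ball (1 + m) (2 + w)) (+-monoˡ-≤ (ball m k) (≤-trans (*-monoˡ-≤ c coeff) (ball-growth m k (1 + w) 3≤k (n≤1+n _) n≥)))) ⟩
  ball (2 + m) (2 + w) + (ball (1 + m) (2 + w) + (ball m (2 + w) + ball m k))
    ∎
  where
  open ≤-Reasoning
  w = u + v
  k = 3 + w
  R = branches u k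
  c = ball m (1 + w)
  3≤k : 3 ≤ k
  3≤k = s≤s (s≤s (s≤s z≤n))
  x≡ : x ≡ ball (2 + m) (2 + w)
  x≡ = +-cancelʳ-≡ (ball (2 + m) k) x (ball (2 + m) (2 + w)) x+≡
  coeff : 27 * k + 7 ≤ 49 * k
  coeff = subst (27 * k + 7 ≤_) (sym (*-distribʳ-+ k 27 22)) (+-monoʳ-≤ (27 * k) (≤-trans (s≤s (s≤s (s≤s (s≤s (s≤s (s≤s (s≤s z≤n))))))) (*-monoʳ-≤ 22 3≤k)))
  R1 : R * ball m (suc v) ≤ 27 * k * c
  R1 = subst (λ y → R * ball m (suc v) ≤ 27 * k * ball m y) (+-suc u v)
    (branches*ball≤ m k u (suc v) 3≤k (≤-trans (≤-reflexive (+-suc u v)) (s≤s (m≤n+m w 2))) n≥)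
  -- Here the parameter is one smaller than in `R1`, so one further growth step, worth 49k, absorbs
  -- the factor 27k.
  R2 : R * ball m v ≤ c
  R2 = ≤-trans (branches*ball≤ m k u v 3≤k (m≤n+m w 3) n≥)
    (≤-trans (*-monoˡ-≤ (ball m w) (*-monoˡ-≤ k (m≤m+n 27 22))) (ball-growth m k w 3≤k (s≤s (m≤n+m w 2)) n≥))
  Rball≤ : R * ball (suc m) (suc v) ≤ 27 * k * c + c
  Rball≤ = ≤-trans (≤-reflexive (trans (*-distribˡ-+ R (ball m v) (ball m (suc v))) (+-comm (R * ball m v) _))) (+-mono-≤ R1 R2)
  collect : ∀ a c b k d → a + (2 * (2 * c) + (2 * c + b)) + (27 * k * c + c) + d ≡ a + (b + ((27 * k + 7) * c + d))
  collect = solve-∀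

-- Finite sets

x∉p-x : (p : Subset n) (x : Fin n) → x ∉ p - x
x∉p-x (_ ∷ p) (suc x) (there x∈) = x∉p-x p x x∈

x∈p-y⇒x≢y : {p : Subset n} {x y : Fin n} → x ∈ p - y → x ≢ y
x∈p-y⇒x≢y {p = p} {x} x∈ refl = x∉p-x p x x∈

x∈p⇒suc∣p-x∣≡∣p∣ : (p : Subset n) {x : Fin n} → x ∈ p → suc ∣ p - x ∣ ≡ ∣ p ∣
x∈p⇒suc∣p-x∣≡∣p∣ (inside ∷ p)  here       = cong (suc ∘ ∣_∣) (p─⊥≡p p)
x∈p⇒suc∣p-x∣≡∣p∣ (inside ∷ p)  (there x∈) = cong suc (x∈p⇒suc∣p-x∣≡∣p∣ p x∈)
x∈p⇒suc∣p-x∣≡∣p∣ (outside ∷ p) (there x∈) = x∈p⇒suc∣p-x∣≡∣p∣ p x∈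

x∉p⇒∣p∪⁅x⁆∣≡suc∣p∣ : (p : Subset n) {x : Fin n} → x ∉ p → ∣ p ∪ ⁅ x ⁆ ∣ ≡ suc ∣ p ∣
x∉p⇒∣p∪⁅x⁆∣≡suc∣p∣ (inside ∷ p)  {zero}  x∉ = contradiction here x∉
x∉p⇒∣p∪⁅x⁆∣≡suc∣p∣ (outside ∷ p) {zero}  x∉ = cong (suc ∘ ∣_∣) (∪-identityʳ p)
x∉p⇒∣p∪⁅x⁆∣≡suc∣p∣ (inside ∷ p)  {suc x} x∉ = cong suc (x∉p⇒∣p∪⁅x⁆∣≡suc∣p∣ p (x∉ ∘ there))
x∉p⇒∣p∪⁅x⁆∣≡suc∣p∣ (outside ∷ p) {suc x} x∉ = x∉p⇒∣p∪⁅x⁆∣≡suc∣p∣ p (x∉ ∘ there)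

∣p∪q∣≤∣p∣+∣q∣ : (p q : Subset n) → ∣ p ∪ q ∣ ≤ ∣ p ∣ + ∣ q ∣
∣p∪q∣≤∣p∣+∣q∣ []            []            = z≤n
∣p∪q∣≤∣p∣+∣q∣ (inside ∷ p)  (inside ∷ q)  = s≤s (≤-trans (∣p∪q∣≤∣p∣+∣q∣ p q) (+-monoʳ-≤ ∣ p ∣ (n≤1+n ∣ q ∣)))
∣p∪q∣≤∣p∣+∣q∣ (inside ∷ p)  (outside ∷ q) = s≤s (∣p∪q∣≤∣p∣+∣q∣ p q)
∣p∪q∣≤∣p∣+∣q∣ (outside ∷ p) (inside ∷ q)  = ≤-trans (s≤s (∣p∪q∣≤∣p∣+∣q∣ p q)) (≤-reflexive (sym (+-suc ∣ p ∣ ∣ q ∣)))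
∣p∪q∣≤∣p∣+∣q∣ (outside ∷ p) (outside ∷ q) = ∣p∪q∣≤∣p∣+∣q∣ p q

two-of-difference : {D A : Subset n} {x y : Fin n} → D ⊆ A → x ∈ A → x ∉ D → y ∈ A → y ∉ D → x ≢ y → suc (suc ∣ D ∣) ≤ ∣ A ∣
two-of-difference {D = D} {A} {x} {y} D⊆A x∈A x∉D y∈A y∉D x≢y = begin
  2 + ∣ D ∣             ≤⟨ s≤s (s≤s (p⊆q⇒∣p∣≤∣q∣ D⊆A-x-y)) ⟩
  2 + ∣ A - x - y ∣     ≡⟨ cong suc (x∈p⇒suc∣p-x∣≡∣p∣ (A - x) (x∈p∧x≢y⇒x∈p-y y∈A (x≢y ∘ sym))) ⟩
  1 + ∣ A - x ∣         ≡⟨ x∈p⇒suc∣p-x∣≡∣p∣ A x∈A ⟩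
  ∣ A ∣                 ∎
  where
  open ≤-Reasoning
  D⊆A-x-y : D ⊆ A - x - y
  D⊆A-x-y z∈D = x∈p∧x≢y⇒x∈p-y (x∈p∧x≢y⇒x∈p-y (D⊆A z∈D) (λ { refl → x∉D z∈D })) (λ { refl → y∉D z∈D })

∈-pair : {E : Subset n} {x y z : Fin n} → ∣ E ∣ ≤ 2 → x ∈ E → y ∈ E → x ≢ y → z ∈ E → z ≡ x ⊎ z ≡ y
∈-pair {E = E} {x} {y} {z} ∣E∣≤2 x∈E y∈E x≢y z∈E with z ≟ x | z ≟ y
... | yes z≡x | _       = inj₁ z≡x
... | no  _   | yes z≡y = inj₂ z≡y
... | no  z≢x | no  z≢y = contradiction ∣E∣≤2 (<⇒≱ (begin
  3                  ≤⟨ s≤s (s≤s (≤-trans (s≤s z≤n) (≤-reflexive (x∈p⇒suc∣p-x∣≡∣p∣ (E - x - y) z∈)))) ⟩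
  2 + ∣ E - x - y ∣  ≡⟨ cong suc (x∈p⇒suc∣p-x∣≡∣p∣ (E - x) (x∈p∧x≢y⇒x∈p-y y∈E (x≢y ∘ sym))) ⟩
  1 + ∣ E - x ∣      ≡⟨ x∈p⇒suc∣p-x∣≡∣p∣ E x∈E ⟩
  ∣ E ∣              ∎))
  where
  open ≤-Reasoning
  z∈ : z ∈ E - x - y
  z∈ = x∈p∧x≢y⇒x∈p-y (x∈p∧x≢y⇒x∈p-y z∈E z≢x) z≢y

⊆∧∣∣≥⇒⊇ : {D A : Subset n} → D ⊆ A → ∣ A ∣ ≤ ∣ D ∣ → A ⊆ D
⊆∧∣∣≥⇒⊇ {D = D} D⊆A ∣A∣≤∣D∣ {x} x∈A with x ∈? D
... | yes x∈D = x∈D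
... | no  x∉D = contradiction ∣A∣≤∣D∣ (<⇒≱ (p⊂q⇒∣p∣<∣q∣ (D⊆A , x , x∈A , x∉D)))

∣A∩B∣<k : {A B : Subset n} {k : ℕ} → ∣ A ∣ ≡ k → ∣ B ∣ ≡ k → A ≢ B → ∣ A ∩ B ∣ < k
∣A∩B∣<k {A = A} {B} refl ∣B∣≡k A≢B = ≰⇒> λ ∣A∣≤ → A≢B (⊆-antisym
  (p∩q⊆q A B ∘ ⊆∧∣∣≥⇒⊇ (p∩q⊆p A B) ∣A∣≤)
  (p∩q⊆p A B ∘ ⊆∧∣∣≥⇒⊇ (p∩q⊆q A B) (subst (_≤ ∣ A ∩ B ∣) (sym ∣B∣≡k) ∣A∣≤)))

-- `D` misses at most one point of `A`, hence at most one point of `W`. That point is deleted; if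
-- there is none, any point of `W` will do.
remove-one : {D A W : Subset n} → D ⊆ A → ∣ A ∣ ≤ suc ∣ D ∣ → W ⊆ A → Nonempty W → ∃ λ w → w ∈ W × W - w ⊆ D
remove-one {D = D} {A} {W} D⊆A ∣A∣≤ W⊆A (v , v∈W) with any? (λ x → (x ∈? W) ×-dec ¬? (x ∈? D))
... | yes (w , w∈W , w∉D) = w , w∈W , λ {x} x∈ → decidable-stable (x ∈? D) λ x∉D →
  <⇒≱ (two-of-difference D⊆A (W⊆A w∈W) w∉D (W⊆A (p─q⊆p W ⁅ w ⁆ x∈)) x∉D (x∈p-y⇒x≢y x∈ ∘ sym)) ∣A∣≤
... | no  none = v , v∈W , λ {x} x∈ → decidable-stable (x ∈? D) λ x∉D → none (x , p─q⊆p W ⁅ v ⁆ x∈ , x∉D)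

elements : Subset n → List (Fin n)
elements []            = []
elements (inside ∷ p)  = zero ∷ map suc (elements p)
elements (outside ∷ p) = map suc (elements p)

length-elements : (p : Subset n) → length (elements p) ≡ ∣ p ∣
length-elements []            = refl
length-elements (inside ∷ p)  = cong suc (trans (length-map suc (elements p)) (length-elements p))
length-elements (outside ∷ p) = trans (length-map suc (elements p)) (length-elements p)

∈-elements⁺ : {p : Subset n} {x : Fin n} → x ∈ p → x LM.∈ elements p
∈-elements⁺ {p = inside ∷ p}  here       = here refl
∈-elements⁺ {p = inside ∷ p}  (there x∈) = there (∈-map⁺ suc (∈-elements⁺ x∈))
∈-elements⁺ {p = outside ∷ p} (there x∈) = ∈-map⁺ suc (∈-elements⁺ x∈)

elements⊆ : (p : Subset n) → All (_∈ p) (elements p)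
elements⊆ []            = []
elements⊆ (inside ∷ p)  = here ∷ All.map⁺ (All.map there (elements⊆ p))
elements⊆ (outside ∷ p) = All.map⁺ (All.map there (elements⊆ p))

allSubsets : ∀ n → List (Subset n)
allSubsets zero    = [] ∷ []
allSubsets (suc n) = map (inside ∷_) (allSubsets n) ++ map (outside ∷_) (allSubsets n)

∈-allSubsets : (D : Subset n) → D LM.∈ allSubsets n
∈-allSubsets []            = here refl
∈-allSubsets (inside ∷ D)  = ∈-++⁺ˡ (∈-map⁺ (inside ∷_) (∈-allSubsets D))
∈-allSubsets (outside ∷ D) = ∈-++⁺ʳ _ (∈-map⁺ (outside ∷_) (∈-allSubsets D))

-- Maximal intersecting families and branching

DisjointFrom : Subset n → Subset n → Set
DisjointFrom C E = ∀ {x} → x ∈ C → x ∉ E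

-- With Candidate = Nonempty, G is maximal among the intersecting families of sets of size at most k. Allowing
-- members smaller than k makes every small transversal of G a member.
record Extension {n} (k : ℕ) (Candidate : Subset n → Set) (F : List (Subset n)) : Set where
  field
    G            : List (Subset n)
    F⊆G          : ∀ {A} → A LM.∈ F → A LM.∈ G
    small        : ∀ {E} → E LM.∈ G → ∣ E ∣ ≤ k
    intersecting : Intersecting (members G)
    maximal      : ∀ {C} → Candidate C → ∣ C ∣ ≤ k → C LM.∈ G ⊎ ∃ λ E → E LM.∈ G × DisjointFrom C E

-- Greedy extension: each candidate is added when it is nonempty, has at most `k` elements and meets
-- all current members. A nonempty candidate of admissible size that is rejected is disjoint from a
-- current member, which stays in the final `G`.
extend : ∀ k (Cs F : List (Subset n)) → (∀ {A} → A LM.∈ F → ∣ A ∣ ≤ k) → Intersecting (members F) → Extension k (λ C → C LM.∈ Cs × Nonempty C) F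
extend k []       F small int = record { G = F ; F⊆G = id ; small = small ; intersecting = int ; maximal = λ { (() , _) } }
extend k (C ∷ Cs) F small int with nonempty? C ×-dec (∣ C ∣ ≤? k) ×-dec All.all? (λ E → nonempty? (C ∩ E)) F
... | yes ((x , x∈C) , ∣C∣≤k , meets) = record
  { G = G ; F⊆G = F⊆G ∘ there ; small = small′ ; intersecting = intersecting
  ; maximal = λ { (here refl , _) _ → inj₁ (F⊆G (here refl)) ; (there B∈Cs , ne) → maximal (B∈Cs , ne) } }
  where
  int⁺ : Intersecting (members (C ∷ F))
  int⁺ A B (here refl) (here refl) = x , x∈p∩q⁺ (x∈C , x∈C)
  int⁺ A B (here refl) (there B∈F) = All.lookup meets B∈F
  int⁺ A B (there A∈F) (here refl) = subst Nonempty (∩-comm C A) (All.lookup meets A∈F)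
  int⁺ A B (there A∈F) (there B∈F) = int A B A∈F B∈F
  small⁺ : ∀ {A} → A LM.∈ (C ∷ F) → ∣ A ∣ ≤ k
  small⁺ (here refl) = ∣C∣≤k
  small⁺ (there A∈F) = small A∈F
  open Extension (extend k Cs (C ∷ F) small⁺ int⁺) renaming (small to small′)
... | no reject = record
  { G = G ; F⊆G = F⊆G ; small = small′ ; intersecting = intersecting
  ; maximal = λ { (here refl , ne) → blocked ne ; (there B∈Cs , ne) → maximal (B∈Cs , ne) } }
  where
  open Extension (extend k Cs F small int) renaming (small to small′)
  blocked : Nonempty C → ∣ C ∣ ≤ k → C LM.∈ G ⊎ ∃ λ E → E LM.∈ G × DisjointFrom C E
  blocked ne ∣C∣≤k =
    let E , E∈F , ¬meet = LM.find (All.¬All⇒Any¬ (λ E → nonempty? (C ∩ E)) F (λ all → reject (ne , ∣C∣≤k , all)))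
    in inj₂ (E , F⊆G E∈F , λ {x} x∈C x∈E → ¬meet (x , x∈p∩q⁺ (x∈C , x∈E)))

saturate : ∀ k (F : List (Subset n)) → (∀ {A} → A LM.∈ F → ∣ A ∣ ≤ k) → Intersecting (members F) → Extension k Nonempty F
saturate {n} k F small int = record
  { G = G ; F⊆G = F⊆G ; small = small′ ; intersecting = intersecting ; maximal = λ ne → maximal (∈-allSubsets _ , ne) }
  where open Extension (extend k (allSubsets n) F small int) renaming (small to small′)

-- Choosing members that avoid `a` and then `b` yields the edges ab, bc and ca of a triangle. Every
-- member meets all three edges, so it contains two of the vertices, and two pairs of vertices
-- always share one.
triangle : {G : List (Subset n)} → Intersecting (members G) → Fin n →
  (∀ x → ∃ λ E → E LM.∈ G × ∣ E ∣ ≤ 2 × x ∉ E) →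
  ∃ λ T → ∣ T ∣ ≤ 3 × ∀ A B → A LM.∈ G → B LM.∈ G → ∃ λ x → x ∈ T × x ∈ A × x ∈ B
triangle {G = G} int o avoid with avoid o
-- The point `o` serves only to obtain a first member `E`; intersecting `E` with itself shows that
-- it is nonempty.
... | E , E∈G , ∣E∣≤2 , _ with int E E E∈G E∈G
... | a , a∈ with avoid a | proj₁ (x∈p∩q⁻ E E a∈)
... | Eₐ , Eₐ∈G , ∣Eₐ∣≤2 , a∉Eₐ | a∈E with int E Eₐ E∈G Eₐ∈G
... | b , b∈ with avoid b | x∈p∩q⁻ E Eₐ b∈
... | E_b , E_b∈G , ∣E_b∣≤2 , b∉E_b | b∈E , b∈Eₐ with int E E_b E∈G E_b∈G | int Eₐ E_b Eₐ∈G E_b∈G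
... | a′ , a′∈ | c , c∈ with x∈p∩q⁻ E E_b a′∈ | x∈p∩q⁻ Eₐ E_b c∈
... | a′∈E , a′∈E_b | c∈Eₐ , c∈E_b = T , ∣T∣≤3 , common
  where
  T = ⁅ a ⁆ ∪ (⁅ b ⁆ ∪ ⁅ c ⁆)
  ∣T∣≤3 : ∣ T ∣ ≤ 3
  ∣T∣≤3 = ≤-trans (∣p∪q∣≤∣p∣+∣q∣ ⁅ a ⁆ (⁅ b ⁆ ∪ ⁅ c ⁆)) (+-mono-≤ (≤-reflexive (∣⁅x⁆∣≡1 a))
    (≤-trans (∣p∪q∣≤∣p∣+∣q∣ ⁅ b ⁆ ⁅ c ⁆) (+-mono-≤ (≤-reflexive (∣⁅x⁆∣≡1 b)) (≤-reflexive (∣⁅x⁆∣≡1 c)))))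
  a∈T : a ∈ T
  a∈T = x∈p∪q⁺ (inj₁ (x∈⁅x⁆ a))
  b∈T : b ∈ T
  b∈T = x∈p∪q⁺ (inj₂ (x∈p∪q⁺ (inj₁ (x∈⁅x⁆ b))))
  c∈T : c ∈ T
  c∈T = x∈p∪q⁺ (inj₂ (x∈p∪q⁺ (inj₂ (x∈⁅x⁆ c))))
  a≢b : a ≢ b
  a≢b refl = a∉Eₐ b∈Eₐ
  b≢c : b ≢ c
  b≢c refl = b∉E_b c∈E_b
  a≢c : a ≢ c
  a≢c refl = a∉Eₐ c∈Eₐ
  a∈E_b : a ∈ E_b
  -- The common point of `E` and `E_b` is `a` or `b`, and `E_b` avoids `b`.
  a∈E_b with ∈-pair ∣E∣≤2 a∈E b∈E a≢b a′∈E
  ... | inj₁ refl = a′∈E_b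
  ... | inj₂ refl = contradiction a′∈E_b b∉E_b
  meets-pair : ∀ {A D x y} → A LM.∈ G → D LM.∈ G → ∣ D ∣ ≤ 2 → x ∈ D → y ∈ D → x ≢ y → x ∈ A ⊎ y ∈ A
  meets-pair {A} {D} A∈G D∈G ∣D∣≤2 x∈D y∈D x≢y with int A D A∈G D∈G
  ... | z , z∈ with x∈p∩q⁻ A D z∈
  ... | z∈A , z∈D with ∈-pair ∣D∣≤2 x∈D y∈D x≢y z∈D
  ... | inj₁ refl = inj₁ z∈A
  ... | inj₂ refl = inj₂ z∈A
  two : ∀ A → A LM.∈ G → (a ∈ A × b ∈ A) ⊎ (a ∈ A × c ∈ A) ⊎ (b ∈ A × c ∈ A)
  two A A∈G with meets-pair A∈G E∈G ∣E∣≤2 a∈E b∈E a≢b | meets-pair A∈G Eₐ∈G ∣Eₐ∣≤2 b∈Eₐ c∈Eₐ b≢c | meets-pair A∈G E_b∈G ∣E_b∣≤2 a∈E_b c∈E_b a≢c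
  ... | inj₁ a∈A | inj₁ b∈A | _        = inj₁ (a∈A , b∈A)
  ... | inj₁ a∈A | inj₂ c∈A | _        = inj₂ (inj₁ (a∈A , c∈A))
  ... | inj₂ b∈A | _        | inj₁ a∈A = inj₁ (a∈A , b∈A)
  ... | inj₂ b∈A | _        | inj₂ c∈A = inj₂ (inj₂ (b∈A , c∈A))
  common : ∀ A B → A LM.∈ G → B LM.∈ G → ∃ λ x → x ∈ T × x ∈ A × x ∈ B
  common A B A∈G B∈G with two A A∈G | two B B∈G
  ... | inj₁ (aA , bA)        | inj₁ (aB , bB)        = a , a∈T , aA , aB
  ... | inj₁ (aA , bA)        | inj₂ (inj₁ (aB , cB)) = a , a∈T , aA , aB
  ... | inj₁ (aA , bA)        | inj₂ (inj₂ (bB , cB)) = b , b∈T , bA , bB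
  ... | inj₂ (inj₁ (aA , cA)) | inj₁ (aB , bB)        = a , a∈T , aA , aB
  ... | inj₂ (inj₁ (aA , cA)) | inj₂ (inj₁ (aB , cB)) = a , a∈T , aA , aB
  ... | inj₂ (inj₁ (aA , cA)) | inj₂ (inj₂ (bB , cB)) = c , c∈T , cA , cB
  ... | inj₂ (inj₂ (bA , cA)) | inj₁ (aB , bB)        = b , b∈T , bA , bB
  ... | inj₂ (inj₂ (bA , cA)) | inj₂ (inj₁ (aB , cB)) = c , c∈T , cA , cB
  ... | inj₂ (inj₂ (bA , cA)) | inj₂ (inj₂ (bB , cB)) = b , b∈T , bA , bB

-- Linear search. With `Star` as `K` it finds a `t` such that some point lies in every member with
-- fewer than `t` elements, but none in every member with at most `t` elements.
first-failure : {K : ℕ → Set} → (∀ s → Dec (K s)) → K 0 → ∀ m → K m ⊎ ∃ λ t → t < m × K t × ¬ K (suc t)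
first-failure K? K0 zero    = inj₁ K0
first-failure K? K0 (suc m) with first-failure K? K0 m
... | inj₂ (t , t<m , Kt , ¬Kt+1) = inj₂ (t , m≤n⇒m≤1+n t<m , Kt , ¬Kt+1)
... | inj₁ Km with K? (suc m)
...   | yes Km+1 = inj₁ Km+1
...   | no ¬Km+1 = inj₂ (m , ≤-refl , Km , ¬Km+1)

-- Collects every `W` of `L` with one point deleted. It carries a cover of members `A` over to the
-- sets `D` that arise from `A` by deleting at most one point, by `remove-one`.
shadow : ∀ {s} (L : List (Subset n)) → All (λ W → ∣ W ∣ ≡ suc s) L →
  ∃ λ L′ → length L′ ≤ suc s * length L × All (λ V → ∣ V ∣ ≡ s) L′ ×
    (∀ {A D} → D ⊆ A → ∣ A ∣ ≤ suc ∣ D ∣ → Any (_⊆ A) L → Any (_⊆ D) L′)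
shadow []      []             = [] , z≤n , [] , λ { _ _ () }
shadow {n} {s} (W ∷ L) (∣W∣≡ ∷ sized) with shadow L sized
... | L′ , few , sized′ , hit =
  map (W -_) (elements W) ++ L′
  , ≤-trans (≤-reflexive (trans (length-++ (map (W -_) (elements W))) (cong (_+ length L′) (trans (length-map (W -_) (elements W)) (trans (length-elements W) ∣W∣≡)))))
      (≤-trans (+-monoʳ-≤ (suc s) few) (≤-reflexive (sym (*-suc (suc s) (length L)))))
  , All.++⁺ (All.map⁺ (All.map (λ w∈W → suc-injective (trans (x∈p⇒suc∣p-x∣≡∣p∣ W w∈W) ∣W∣≡)) (elements⊆ W))) sized′
  , λ { D⊆A ∣A∣≤ (here W⊆A) → let w , w∈W , W-w⊆D = remove-one D⊆A ∣A∣≤ W⊆A nonempty in Any.++⁺ˡ (Any.map⁺ (LM.lose (∈-elements⁺ w∈W) W-w⊆D))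
      ; D⊆A ∣A∣≤ (there any)  → Any.++⁺ʳ (map (W -_) (elements W)) (hit D⊆A ∣A∣≤ any) }
  where
  nonempty : Nonempty W
  nonempty = decidable-stable (nonempty? W) λ empty →
    contradiction (trans (sym ∣W∣≡) (trans (cong ∣_∣ (Empty-unique empty)) (∣⊥∣≡0 n))) λ ()

module Branching {n k} {F : List (Subset n)} (S : Extension k Nonempty F) (t : ℕ) (o : Fin n)
  (small∋o : ∀ {E} → E LM.∈ Extension.G S → ∣ E ∣ < t → o ∈ E)
  (avoid : ∀ x → ∃ λ E → E LM.∈ Extension.G S × ∣ E ∣ ≤ t × x ∉ E)
  (t≤k : t ≤ k)
  where

  open Extension S

  Captures : List (Subset n) → Subset n → Fin n → Set
  Captures L W x = ∀ {A} → A LM.∈ G → o ∉ A → W ⊆ A → x ∈ A → Any (_⊆ A) L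

  -- The leaves of a branching tree rooted at `W`: `t`-sets, at most `N` of them, that catch all
  -- members above `W` avoiding `o`.
  record Cover (W : Subset n) (N : ℕ) : Set where
    field
      leaves : List (Subset n)
      few    : length leaves ≤ N
      sized  : All (λ V → ∣ V ∣ ≡ t) leaves
      covers : ∀ {A} → A LM.∈ G → o ∉ A → W ⊆ A → Any (_⊆ A) leaves
  open Cover public

  -- Every member `A` meets `E`, so if `A` contains `W` it also contains `W ∪ ⁅ x ⁆` for some `x` in
  -- `E`. The covers for these at most `b` sets are concatenated.
  branch : ∀ {W E b N} → ∣ E ∣ ≤ b → E LM.∈ G → (∀ {x} → x ∈ E → Cover (W ∪ ⁅ x ⁆) N) → Cover W (b * N)
  branch {W} {E} {b} {N} ∣E∣≤b E∈G sub =
    let L , few , sized , hit = go (elements E) (elements⊆ E)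
    in record
      { leaves = L
      ; few    = ≤-trans few (*-monoˡ-≤ N (≤-trans (≤-reflexive (length-elements E)) ∣E∣≤b))
      ; sized  = sized
      ; covers = λ {A} A∈G o∉A W⊆A →
          let x , x∈ = intersecting E A E∈G A∈G
              x∈E , x∈A = x∈p∩q⁻ E A x∈
          in hit (∈-elements⁺ x∈E) A∈G o∉A W⊆A x∈A
      }
    where
    go : ∀ xs → All (_∈ E) xs → ∃ λ L → length L ≤ length xs * N × All (λ V → ∣ V ∣ ≡ t) L × (∀ {x} → x LM.∈ xs → Captures L W x)
    go []       _            = [] , z≤n , [] , λ ()
    go (y ∷ xs) (y∈E ∷ xs∈E) with sub y∈E | go xs xs∈E
    ... | C | L , few′ , sized′ , hit =
      leaves C ++ L
      , ≤-trans (≤-reflexive (length-++ (leaves C))) (+-mono-≤ (few C) few′)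
      , All.++⁺ (sized C) sized′
      , λ { (here refl)  A∈G o∉A W⊆A y∈A → Any.++⁺ˡ (covers C A∈G o∉A (λ z∈ → [ W⊆A , (λ z∈y → subst (_∈ _) (sym (x∈⁅y⁆⇒x≡y y z∈y)) y∈A) ]′ (x∈p∪q⁻ W ⁅ y ⁆ z∈)))
          ; (there x∈xs) A∈G o∉A W⊆A x∈A → Any.++⁺ʳ (leaves C) (hit x∈xs A∈G o∉A W⊆A x∈A) }

  -- While `W` has fewer than `t` elements, maximality leaves two cases. Either `W` is itself a
  -- member, hence contains `o`, and nothing above it has to be covered; or `W` is disjoint from a
  -- member, whose at most `k` points give the branches.
  grow : ∀ s W → Nonempty W → ∣ W ∣ + s ≡ t → Cover W (k ^ s)
  grow zero    W ne ∣W∣≡ = record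
    { leaves = W ∷ [] ; few = ≤-refl ; sized = trans (sym (+-identityʳ ∣ W ∣)) ∣W∣≡ ∷ [] ; covers = λ _ _ W⊆A → here W⊆A }
  grow (suc s) W ne@(w , w∈W) ∣W∣+ with maximal ne (≤-trans (m≤m+n ∣ W ∣ (suc s)) (≤-trans (≤-reflexive ∣W∣+) t≤k))
  ... | inj₁ W∈G = record
    { leaves = [] ; few = z≤n ; sized = []
    ; covers = λ _ o∉A W⊆A → contradiction (W⊆A (small∋o W∈G (≤-trans (m<m+n ∣ W ∣ (s≤s z≤n)) (≤-reflexive ∣W∣+)))) o∉A }
  ... | inj₂ (E , E∈G , disjoint) = branch (small E∈G) E∈G λ {x} x∈E →
    grow s (W ∪ ⁅ x ⁆) (w , x∈p∪q⁺ (inj₁ w∈W))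
      (trans (cong (_+ s) (x∉p⇒∣p∪⁅x⁆∣≡suc∣p∣ W (λ x∈W → disjoint x∈W x∈E))) (trans (sym (+-suc ∣ W ∣ s)) ∣W∣+))

  -- The first two steps can use members with at most t elements, which saves a factor k² / t².
  root : ∀ s → 2 + s ≡ t → Cover ⊥ (t * (t * k ^ s))
  root s 2+s≡t with avoid o
  ... | E , E∈G , ∣E∣≤t , _ = branch ∣E∣≤t E∈G λ {x} _ → second x (avoid x)
    where
    second : ∀ x → (∃ λ E → E LM.∈ G × ∣ E ∣ ≤ t × x ∉ E) → Cover (⊥ ∪ ⁅ x ⁆) (t * k ^ s)
    -- `E′` avoids `x`, so the second point differs from the first and `grow` starts from a set of
    -- size 2.
    second x (E′ , E′∈G , ∣E′∣≤t , x∉E′) = branch ∣E′∣≤t E′∈G λ {y} y∈E′ →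
      grow s ((⊥ ∪ ⁅ x ⁆) ∪ ⁅ y ⁆) (y , x∈p∪q⁺ (inj₂ (x∈⁅x⁆ y))) (trans (cong (_+ s)
        (trans (x∉p⇒∣p∪⁅x⁆∣≡suc∣p∣ (⊥ {n} ∪ ⁅ x ⁆) (y∉ y∈E′)) (cong suc (trans (x∉p⇒∣p∪⁅x⁆∣≡suc∣p∣ (⊥ {n}) {x} ∉⊥) (cong suc (∣⊥∣≡0 n)))))) 2+s≡t)
      where
      y∉ : ∀ {y} → y ∈ E′ → y ∉ ⊥ ∪ ⁅ x ⁆
      y∉ y∈E′ y∈ with x∈p∪q⁻ ⊥ ⁅ x ⁆ y∈
      ... | inj₁ y∈⊥ = ∉⊥ y∈⊥
      ... | inj₂ y∈x = x∉E′ (subst (_∈ E′) (x∈⁅y⁆⇒x≡y x y∈x) y∈E′)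

  -- Handles the intersections of the third kind: deleting a point of `A` may cost one point of the
  -- leaf below it, hence size `t` - 1 and a further factor `t`.
  shadow-cover : ∀ s → 2 + s ≡ t → ∃ λ L → length L ≤ t * (t * (t * k ^ s)) × All (λ V → ∣ V ∣ ≡ suc s) L ×
    (∀ {A D} → A LM.∈ G → o ∉ A → D ⊆ A → ∣ A ∣ ≤ suc ∣ D ∣ → Any (_⊆ D) L)
  shadow-cover s refl =
    let C = root s refl
        L , few′ , sized′ , hit = shadow (leaves C) (sized C)
    in L , ≤-trans few′ (*-monoʳ-≤ t (few C)) , sized′
       , λ A∈G o∉A D⊆A ∣A∣≤ → hit D⊆A ∣A∣≤ (covers C A∈G o∉A (λ x∈⊥ → contradiction x∈⊥ ∉⊥))

-- The intersections of an intersecting family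

-- Counts with multiplicity, so that its total is a plain sum over `L`: the union bound.
coverage : List (Subset n) → ℕ → Subset n → ℕ
coverage []      k D = 0
coverage (V ∷ L) k D = ind (above? V k D) + coverage L k D

1≤coverage : {L : List (Subset n)} {k : ℕ} {D : Subset n} → ∣ D ∣ < k → Any (_⊆ D) L → 1 ≤ coverage L k D
1≤coverage {L = V ∷ L} {k} {D} ∣D∣<k (here V⊆D) = ≤-trans (≤-reflexive (sym (ind-yes (above? V k D) (V⊆D , ∣D∣<k)))) (m≤m+n _ _)
1≤coverage {L = V ∷ L} {k} {D} ∣D∣<k (there any) = ≤-trans (1≤coverage ∣D∣<k any) (m≤n+m _ (ind (above? V k D)))

total-coverage : ∀ s i (L : List (Subset n)) → All (λ V → ∣ V ∣ ≡ s) L → total (coverage L (s + i)) ≤ length L * ball (n ∸ s) i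
total-coverage {n} s i []      []               = ≤-reflexive (total-zero {n} (λ _ → refl))
total-coverage {n} s i (V ∷ L) (refl ∷ sized) = begin
  total (coverage (V ∷ L) (s + i))                                        ≡⟨ total-+ (λ D → ind (above? V (s + i) D)) (coverage L (s + i)) ⟩
  total (λ D → ind (above? V (s + i) D)) + total (coverage L (s + i))     ≤⟨ +-mono-≤ (≤-reflexive (trans (total-above V i) (cong (λ x → ball x i) (∣∁p∣≡n∸∣p∣ V)))) (total-coverage s i L sized) ⟩
  ball (n ∸ s) i + length L * ball (n ∸ s) i                              ∎
  where open ≤-Reasoning

common⇒Meets : ∀ {T D : Subset n} {x k} → x ∈ T → x ∈ D → ∣ D ∣ < k → Meets T k D
common⇒Meets x∈T x∈D ∣D∣<k = (λ D⊆∁T → x∈∁p⇒x∉p (D⊆∁T x∈D) x∈T) , ∣D∣<k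

module _ (m k : ℕ) (F : List (Subset (3 + m))) (uniform : IsKUniform k (members F)) (S : Extension k Nonempty F)
  (n≥ : 50 * (k * k) ≤ 3 + m) {p : ℕ} (size : HasSize (𝓘 (members F)) p) where

  open Extension S

  private
    Iᶠ = proj₁ size
    unique = proj₁ (proj₁ (proj₂ size))
    length≡p = proj₂ (proj₂ size)

  ∈Iᶠ⁻ : ∀ {D} → D LM.∈ Iᶠ → ∃ λ A → ∃ λ B → A LM.∈ F × B LM.∈ F × ∣ D ∣ < k × D ≡ A ∩ B
  ∈Iᶠ⁻ {D} D∈ with proj₁ (proj₂ (proj₁ (proj₂ size)) D) D∈
  ... | A , B , A∈F , B∈F , A≢B , refl = A , B , A∈F , B∈F , ∣A∩B∣<k (uniform A A∈F) (uniform B B∈F) A≢B , refl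

  p≤total : {f : Subset (3 + m) → ℕ} → (∀ D → D LM.∈ Iᶠ → 1 ≤ f D) → p ≤ total f
  p≤total 1≤f = subst (_≤ _) length≡p (length≤total unique 1≤f)

  -- All intersections meet `T`, and at least `m` points lie outside `T`, so at least `ball m k` of
  -- the sets with fewer than `k` elements are excluded. Serves the star and the triangle case.
  transversal-bound : (T : Subset (3 + m)) → ∣ T ∣ ≤ 3 → (∀ A B → A LM.∈ F → B LM.∈ F → ∃ λ x → x ∈ T × x ∈ A × x ∈ B) →
    p + ball m k ≤ ball (3 + m) k
  transversal-bound T ∣T∣≤3 common = begin
    p + ball m k                                        ≤⟨ +-mono-≤ (p≤total 1≤) (ball-monoˡ k m≤∣∁T∣) ⟩
    total (λ D → ind (meets? T k D)) + ball ∣ ∁ T ∣ k   ≡⟨ total-meets T k ⟩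
    ball (3 + m) k                                      ∎
    where
    open ≤-Reasoning
    m≤∣∁T∣ : m ≤ ∣ ∁ T ∣
    m≤∣∁T∣ = ≤-trans (∸-monoʳ-≤ (3 + m) ∣T∣≤3) (≤-reflexive (sym (∣∁p∣≡n∸∣p∣ T)))
    1≤ : ∀ D → D LM.∈ Iᶠ → 1 ≤ ind (meets? T k D)
    1≤ D D∈ with ∈Iᶠ⁻ D∈
    ... | A , B , A∈F , B∈F , ∣D∣<k , refl =
      let x , x∈T , x∈A , x∈B = common A B A∈F B∈F
      in ≤-reflexive (sym (ind-yes (meets? T k D) (common⇒Meets x∈T (x∈p∩q⁺ (x∈A , x∈B)) ∣D∣<k)))

  -- Each intersection is counted by `f₁` if it contains `o`, by `f₂` if it has fewer than `k` - 1
  -- elements, and otherwise by `f₃`, since it then contains a set of `L`.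
  shadow-bound : ∀ u v → 3 + (u + v) ≡ k → (o : Fin (3 + m)) (L : List (Subset (3 + m))) →
    length L ≤ branches u k → All (λ V → ∣ V ∣ ≡ 2 + u) L →
    (∀ {A D} → A LM.∈ F → o ∉ A → D ⊆ A → ∣ A ∣ ≤ suc ∣ D ∣ → Any (_⊆ D) L) → p + ball m k ≤ ball (3 + m) k
  shadow-bound u v refl o L ∣L∣≤ sized hit = begin
    p + ball m k                                                         ≤⟨ +-monoˡ-≤ (ball m k) (p≤total 1≤f) ⟩
    total f + ball m k                                                   ≡⟨ cong (_+ ball m k) total-f ⟩
    total f₁ + total f₂ + total f₃ + ball m k                            ≤⟨ +-monoˡ-≤ (ball m k) (+-mono-≤ (≤-reflexive (cong (total f₁ +_) total-f₂)) total-f₃) ⟩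
    total f₁ + ball (3 + m) k₁ + branches u k * ball (suc m) (suc v) + ball m k  ≤⟨ branching-bound m u v n≥ (total f₁) total-f₁ ⟩
    ball (3 + m) k                                                       ∎
    where
    open ≤-Reasoning
    k₁ = 2 + (u + v)
    f₁ f₂ f₃ f : Subset (3 + m) → ℕ
    f₁ D = ind (meets? ⁅ o ⁆ k D)
    f₂ D = ind (within? ⊤ k₁ D)
    f₃ D = coverage L k D
    f D = f₁ D + f₂ D + f₃ D
    total-f : total f ≡ total f₁ + total f₂ + total f₃
    total-f = trans (total-+ (λ D → f₁ D + f₂ D) f₃) (cong (_+ total f₃) (total-+ f₁ f₂))
    total-f₁ : total f₁ + ball (2 + m) k ≡ ball (3 + m) k
    total-f₁ = trans (cong (λ x → total f₁ + ball x k) (sym (trans (∣∁p∣≡n∸∣p∣ ⁅ o ⁆) (cong (3 + m ∸_) (∣⁅x⁆∣≡1 o))))) (total-meets ⁅ o ⁆ k)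
    total-f₂ : total f₂ ≡ ball (3 + m) k₁
    total-f₂ = trans (total-within (⊤ {3 + m}) k₁) (cong (λ x → ball x k₁) (∣⊤∣≡n (3 + m)))
    total-f₃ : total f₃ ≤ branches u k * ball (suc m) (suc v)
    total-f₃ = begin
      -- Rewrites `k` as `2 + u` plus `suc v`: the size of the sets in `L` and the bound on what is
      -- added to them.
      total f₃                                        ≡⟨ cong (λ x → total (coverage L (2 + x))) (+-suc u v) ⟨
      total (coverage L (2 + u + suc v))              ≤⟨ total-coverage (2 + u) (suc v) L sized ⟩
      length L * ball (suc m ∸ u) (suc v)             ≤⟨ *-mono-≤ ∣L∣≤ (ball-monoˡ (suc v) (m∸n≤m (suc m) u)) ⟩
      branches u k * ball (suc m) (suc v)             ∎
    -- One of `A` and `B` avoids `o`, and it exceeds the intersection by at most one point.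
    covered : ∀ {A B} → A LM.∈ F → B LM.∈ F → o ∉ A ∩ B → k₁ ≤ ∣ A ∩ B ∣ → Any (_⊆ A ∩ B) L
    covered {A} {B} A∈F B∈F o∉ k₁≤ with o ∈? A | o ∈? B
    ... | no o∉A  | _       = hit A∈F o∉A (p∩q⊆p A B) (≤-trans (≤-reflexive (uniform A A∈F)) (s≤s k₁≤))
    ... | yes _   | no o∉B  = hit B∈F o∉B (p∩q⊆q A B) (≤-trans (≤-reflexive (uniform B B∈F)) (s≤s k₁≤))
    ... | yes o∈A | yes o∈B = contradiction (x∈p∩q⁺ (o∈A , o∈B)) o∉
    cases : ∀ {D A B} → A LM.∈ F → B LM.∈ F → ∣ D ∣ < k → D ≡ A ∩ B → Dec (o ∈ D) → Dec (∣ D ∣ < k₁) → 1 ≤ f D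
    cases {D} _ _ ∣D∣<k _ (yes o∈D) _ = begin
      1        ≡⟨ ind-yes (meets? ⁅ o ⁆ k D) (common⇒Meets (x∈⁅x⁆ o) o∈D ∣D∣<k) ⟨
      f₁ D     ≤⟨ ≤-trans (m≤m+n (f₁ D) (f₂ D)) (m≤m+n (f₁ D + f₂ D) (f₃ D)) ⟩
      f D      ∎
    cases {D} _ _ _ _ (no _) (yes ∣D∣<k₁) = begin
      1        ≡⟨ ind-yes (within? ⊤ k₁ D) (⊆⊤ , ∣D∣<k₁) ⟨
      f₂ D     ≤⟨ ≤-trans (m≤n+m (f₂ D) (f₁ D)) (m≤m+n (f₁ D + f₂ D) (f₃ D)) ⟩
      f D      ∎
    cases {D} A∈F B∈F ∣D∣<k refl (no o∉D) (no ∣D∣≮k₁) =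
      ≤-trans (1≤coverage ∣D∣<k (covered A∈F B∈F o∉D (≮⇒≥ ∣D∣≮k₁))) (m≤n+m (f₃ D) (f₁ D + f₂ D))
    1≤f : ∀ D → D LM.∈ Iᶠ → 1 ≤ f D
    1≤f D D∈ = let _ , _ , A∈F , B∈F , ∣D∣<k , D≡ = ∈Iᶠ⁻ D∈ in cases A∈F B∈F ∣D∣<k D≡ (o ∈? D) (∣ D ∣ <? k₁)

  -- The critical size `t` and the case distinction

  Through : ℕ → Fin (3 + m) → Subset (3 + m) → Set
  Through s x E = ∣ E ∣ < s → x ∈ E

  through? : ∀ s x E → Dec (Through s x E)
  through? s x E = (∣ E ∣ <? s) →-dec (x ∈? E)

  -- `Star 0` holds vacuously. `Star (suc k)` puts one point into all of `G`, whose members have at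
  -- most `k` elements.
  Star : ℕ → Set
  Star s = ∃ λ x → All (Through s x) G

  star? : ∀ s → Dec (Star s)
  star? s = any? (λ x → All.all? (through? s x) G)

  ¬Star⇒avoid : ∀ t → ¬ Star (suc t) → ∀ x → ∃ λ E → E LM.∈ G × ∣ E ∣ ≤ t × x ∉ E
  ¬Star⇒avoid t ¬star x with LM.find (All.¬All⇒Any¬ (through? (suc t) x) G (λ all → ¬star (x , all)))
  ... | E , E∈G , ¬through = E , E∈G
    , decidable-stable (∣ E ∣ ≤? t) (λ ≰t → ¬through (λ <t → contradiction (s≤s⁻¹ <t) ≰t))
    , λ x∈E → ¬through (λ _ → x∈E)

  branching-case : ∀ u v → 3 + (u + v) ≡ k → (o : Fin (3 + m)) → All (Through (3 + u) o) G →
    (∀ x → ∃ λ E → E LM.∈ G × ∣ E ∣ ≤ 3 + u × x ∉ E) → p + ball m k ≤ ball (3 + m) k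
  branching-case u v refl o through avoid =
    let L , few , sized , hit = shadow-cover (suc u) refl
    in shadow-bound u v refl o L few sized (λ A∈F → hit (F⊆G A∈F))
    where open Branching S (3 + u) o (λ E∈G → All.lookup through E∈G) avoid (s≤s (s≤s (s≤s (m≤m+n u v))))

  triangle-case : ∀ t → t ≤ 2 → (∀ x → ∃ λ E → E LM.∈ G × ∣ E ∣ ≤ t × x ∉ E) → p + ball m k ≤ ball (3 + m) k
  triangle-case t t≤2 avoid =
    let T , ∣T∣≤3 , common = triangle intersecting zero (λ x → let E , E∈G , ∣E∣≤t , x∉E = avoid x in E , E∈G , ≤-trans ∣E∣≤t t≤2 , x∉E)
    in transversal-bound T ∣T∣≤3 (λ A B A∈F B∈F → common A B (F⊆G A∈F) (F⊆G B∈F))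

  star-case : Star (suc k) → p + ball m k ≤ ball (3 + m) k
  star-case (x , all) = transversal-bound ⁅ x ⁆ (≤-trans (≤-reflexive (∣⁅x⁆∣≡1 x)) (s≤s z≤n)) (λ A B A∈F B∈F → x , x∈⁅x⁆ x , x∈F A∈F , x∈F B∈F)
    where
    x∈F : ∀ {A} → A LM.∈ F → x ∈ A
    x∈F A∈F = All.lookup all (F⊆G A∈F) (s≤s (small (F⊆G A∈F)))

  ∣𝓘F∣-bound : p + ball m k ≤ ball (3 + m) k
  ∣𝓘F∣-bound with first-failure star? (zero , All.tabulate (λ _ ())) (suc k)
  ... | inj₁ star = star-case star
  ... | inj₂ (t , t<1+k , (o , through) , ¬star) with 3 ≤? t
  ...   | no 3≰t = triangle-case t (s≤s⁻¹ (≰⇒> 3≰t)) (¬Star⇒avoid t ¬star)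
  -- Writing `t` = 3 + u and `k` = t + v also supplies 3 ≤ k, on which the growth estimates rely.
  ...   | yes 3≤t with m≤n⇒∃[o]m+o≡n 3≤t | m≤n⇒∃[o]m+o≡n (s≤s⁻¹ t<1+k)
  ...     | u , refl | v , t+v≡k = branching-case u v t+v≡k o through (¬Star⇒avoid t ¬star)

theorem1p4 : (n k : ℕ) → 2 ≤ k → 50 * (k * k) ≤ n → (F : List (Subset n)) → IsKUniform k (members F) → Intersecting (members F) → (p q : ℕ) → HasSize (𝓘 (members F)) p → HasSize (𝓘 (𝓐 n k)) q → p ≤ q
theorem1p4 n k@(suc k′) 2≤k n≥ F uniform int p q sizeF size𝓐 with m≤n⇒∃[o]m+o≡n {3} {n} (≤-trans (≤-trans (m≤m+n 3 47) (*-monoʳ-≤ 50 {1} (s≤s z≤n))) n≥)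
-- With n = 3 + m, both bounds meet at `ball (3 + m) k`: it is at least `p + ball m k` and at most
-- `q + ball m k`.
... | m , refl = +-cancelʳ-≤ (ball m k) p q (≤-trans (∣𝓘F∣-bound m k F uniform (saturate k F (λ {A} A∈F → ≤-reflexive (uniform A A∈F)) int) n≥ sizeF) (ball≤∣𝓘𝓐∣ m k q 2k≤n size𝓐))
  where
  open ≤-Reasoning
  2k≤n : k + k ≤ 3 + m
  2k≤n = begin
    k + k         ≡⟨ cong (k +_) (+-identityʳ k) ⟨
    2 * k         ≤⟨ *-mono-≤ (m≤m+n 2 48) (m≤m*n k k) ⟩
    50 * (k * k)  ≤⟨ n≥ ⟩
    3 + m         ∎
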